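{- Let $q$ be a prime power, and let $f\in\mathcal{LP}_q$ and $a,b\in\mathbb{F}_q$ be such that $f(a,b)=0$. Then $f$ is principal isotopic to the reduced polynomial $$\rho_{f,a,b}:=f[p_{f,a,b}+a,\,q_{f,a,b}+b]\in\mathcal{RLP}_q,$$ where $p_{f,a,b}:=(f(x+a,b))^{ -1}\in\mathcal{P}_q$ and $q_{f,a,b}:=(f(a,x+b))^{ -1}\in\mathcal{P}_q$.
   Context: $\mathbb{F}_q$ is the finite field with $q$ elements. $\mathcal{P}_q$ is the set of polynomials in $\mathbb{F}_q[x]$ of degree less than $q$ that act as permutations of $\mathbb{F}_q$; the inverse $g^{ -1}\in\mathcal{P}_q$ of $g\in\mathcal{P}_q$ is the compositional inverse, i.e. $g(g^{ -1}(x))=g^{ -1}(g(x))=x$ modulo $x^q-x$. $\mathcal{LP}_q$ is the set of polynomials $f\in\mathbb{F}_q[x,y]$ of degree less than $q$ in each variable such that, for every $c\in\mathbb{F}_q$, both $f(x,c)$ and $f(c,x)$ act as permutations of $\mathbb{F}_q$. $\mathcal{RLP}_q$ is the set of reduced polynomials in $\mathcal{LP}_q$, i.e. those $f$ with $f(x,0)=x$ and $f(0,y)=y$. For $f\in\mathcal{LP}_q$ and $g,h\in\mathcal{P}_q$, $f[g,h]:=f(g(x),h(y))$, the composition being taken modulo $x^q-x$ and $y^q-y$. Two polynomials $f,g\in\mathcal{LP}_q$ are principal isotopic if $g[h_1,h_2]=f$ for some $h_1,h_2\in\mathcal{P}_q$. -}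

module Defs where

open import Algebra.Apartness.Bundles using (HeytingField; HeytingCommutativeRing)
open import Algebra.Bundles using (CommutativeRing; Semiring)
open import Algebra.Bundles.Raw using (RawSemiring)
import Algebra.Definitions.RawSemiring as RawSemiringOps
open import Data.Bool.Base using (if_then_else_)
open import Data.Fin.Base using (Fin; toℕ)
open import Data.Nat.Base as ℕ using (ℕ; suc; _<ᵇ_; _≡ᵇ_)
open import Data.Nat.Primality using (Prime)
open import Data.Product using (∃₂; _×_)
open import Data.Vec.Functional using (Vector)
open import Function.Bundles using (Inverse)
open import Function.Definitions using (Bijective)
open import Relation.Binary.Core using (Rel)
open import Relation.Binary.PropositionalEquality as ≡ using (_≡_)
open import Relation.Unary using (Pred; _∈_)

IsPrimePower : Pred ℕ _
IsPrimePower q = ∃₂ λ p k → Prime p × q ≡ p ℕ.^ suc k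

-- In a Heyting field, x # y holds exactly when x - y is invertible, so 1# # 0#.
-- Once the field is in bijection with Fin q, both ≈ and invertibility are
-- decidable, so by tightness every x ≉ 0# is invertible: the Heyting fields
-- with q elements are the usual fields with q elements.
HasCardinality : ∀ {c ℓ₁ ℓ₂} → HeytingField c ℓ₁ ℓ₂ → ℕ → Set _
HasCardinality F q = Inverse (HeytingField.setoid F) (≡.setoid (Fin q))

module Polynomials {c ℓ₁ ℓ₂} (F : HeytingField c ℓ₁ ℓ₂) (q : ℕ) where

  private
    module F = CommutativeRing
      (HeytingCommutativeRing.commutativeRing (HeytingField.heytingCommutativeRing F))
    module 𝔽 = RawSemiringOps (Semiring.rawSemiring F.semiring)
  open F using (Carrier; _≈_; 0#; 1#)
  open 𝔽 using (sum)

  -- Polynomials of degree less than q (in each variable), as vectors of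
  -- coefficients: the entry at i is the coefficient of xⁱ, the entry at i , j
  -- that of xⁱyʲ.
  Poly : Set c
  Poly = Vector Carrier q

  Poly₂ : Set c
  Poly₂ = Vector (Vector Carrier q) q

  infix 4 _≋_ _≋₂_

  _≋_ : Rel Poly ℓ₁
  g ≋ h = ∀ i → g i ≈ h i

  _≋₂_ : Rel Poly₂ ℓ₁
  f ≋₂ f′ = ∀ i j → f i j ≈ f′ i j

  eval : Poly → Carrier → Carrier
  eval g s = sum λ i → g i F.* s 𝔽.^ toℕ i

  eval₂ : Poly₂ → Carrier → Carrier → Carrier
  eval₂ f s t = sum λ i → sum λ j → f i j F.* (s 𝔽.^ toℕ i F.* t 𝔽.^ toℕ j)

  -- Modulo x^q - x, one has xⁿ = x^(n-(q-1)) for n ≥ q.  For n ≤ 2q - 2, the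
  -- largest degree in a product of two polynomials of degree less than q, a
  -- single such step brings the exponent below q.
  reduceExponent : ℕ → ℕ
  reduceExponent n = if n <ᵇ q then n else n ℕ.∸ (q ℕ.∸ 1)

  monomial : ℕ → Poly
  monomial n k = if n ≡ᵇ toℕ k then 1# else 0#

  infixl 7 _⊗_
  infixl 6 _⊕_

  C : Carrier → Poly
  C s k = s F.* monomial 0 k

  X : Poly
  X = monomial 1

  _⊕_ : Poly → Poly → Poly
  (g ⊕ h) k = g k F.+ h k

  _⊗_ : Poly → Poly → Poly
  (g ⊗ h) k = sum λ i → sum λ j →
    (g i F.* h j) F.* monomial (reduceExponent (toℕ i ℕ.+ toℕ j)) k

  -- The ring F[x]/(x^q - x), on representatives of degree less than q.
  rawSemiring : RawSemiring c ℓ₁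
  rawSemiring = record
    { Carrier = Poly ; _≈_ = _≋_ ; _+_ = _⊕_ ; _*_ = _⊗_ ; 0# = C 0# ; 1# = C 1# }

  private
    module 𝔽[X] = RawSemiringOps rawSemiring

  infixl 8 _⟨_⟩ _⟨_,_⟩ _[_,_]

  -- g(h(x)) modulo x^q - x.
  _⟨_⟩ : Poly → Poly → Poly
  g ⟨ h ⟩ = 𝔽[X].sum λ i → C (g i) ⊗ h 𝔽[X].^ toℕ i

  -- f(g(x),h(x)) modulo x^q - x, a polynomial in a single variable.  When one
  -- of g, h is constant and the other has degree 1, no reduction takes place.
  _⟨_,_⟩ : Poly₂ → Poly → Poly → Poly
  f ⟨ g , h ⟩ = 𝔽[X].sum λ i → 𝔽[X].sum λ j →
    C (f i j) ⊗ (g 𝔽[X].^ toℕ i ⊗ h 𝔽[X].^ toℕ j)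

  -- f(g(x),h(y)) modulo x^q - x and y^q - y.  As g(x)ⁱ involves only x and
  -- h(y)ʲ only y, the coefficient of xᵐyⁿ in g(x)ⁱh(y)ʲ is the product of
  -- those of xᵐ in g(x)ⁱ and of yⁿ in h(y)ʲ.
  _[_,_] : Poly₂ → Poly → Poly → Poly₂
  (f [ g , h ]) m n = sum λ i → sum λ j →
    f i j F.* ((g 𝔽[X].^ toℕ i) m F.* (h 𝔽[X].^ toℕ j) n)

  𝓟 : Pred Poly _
  𝓟 g = Bijective _≈_ _≈_ (eval g)

  𝓛𝓟 : Pred Poly₂ _
  𝓛𝓟 f = ∀ s → f ⟨ X , C s ⟩ ∈ 𝓟 × f ⟨ C s , X ⟩ ∈ 𝓟

  𝓡𝓛𝓟 : Pred Poly₂ _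
  𝓡𝓛𝓟 f = f ∈ 𝓛𝓟 × f ⟨ X , C 0# ⟩ ≋ X × f ⟨ C 0# , X ⟩ ≋ X

  infix 4 _IsInverseOf_

  _IsInverseOf_ : Rel Poly _
  g′ IsInverseOf g = g′ ∈ 𝓟 × g ⟨ g′ ⟩ ≋ X × g′ ⟨ g ⟩ ≋ X

  PrincipalIsotopic : Rel Poly₂ _
  PrincipalIsotopic f g = ∃₂ λ h₁ h₂ → h₁ ∈ 𝓟 × h₂ ∈ 𝓟 × g [ h₁ , h₂ ] ≋₂ f

{-# OPTIONS --safe #-}
-- Everything is read off the values of polynomials.  Evaluation respects the
-- operations modulo x^q - x because x^q = x on F (multiply u(xy) over all y,
-- where u replaces 0 by 1), and it is injective on polynomials of degree less
-- than q because such a polynomial with q roots vanishes.  Every function on F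
-- is a polynomial function, by interpolation with 1 - (x - a)^(q-1), so
-- permutation polynomials have inverses.  Let p - a and r - b be the inverses of
-- f(x+a,b) and f(a,x+b), so that f(p(x),b) = x, f(a,r(y)) = y and ρ = f[p,r].
-- Since f(a,b) = 0, p(0) = a and r(0) = b, so ρ(x,0) = x and ρ(0,y) = y.  Since
-- p(f(x,b)) = x and r(f(a,y)) = y, substituting f(x,b) and f(a,y) into ρ gives
-- back f.
module Submission where

open import Algebra.Apartness.Bundles using (HeytingField; HeytingCommutativeRing)
import Algebra.Apartness.Properties.HeytingCommutativeRing as HeytingProperties
open import Algebra.Bundles using (CommutativeRing; Monoid)
import Algebra.Definitions.RawSemiring as RawSemiringOps
import Algebra.Properties.AbelianGroup as AbelianGroupProperties
import Algebra.Properties.CommutativeMonoid.Sum as CommutativeMonoidSum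
import Algebra.Properties.CommutativeSemigroup as CommutativeSemigroupProperties
import Algebra.Properties.Monoid.Sum as MonoidSum
import Algebra.Properties.Semiring.Exp as Exp
import Algebra.Properties.Semiring.Sum as SemiringSum
import Algebra.Solver.Ring.NaturalCoefficients.Default as SemiringSolver
open import Data.Bool.Base using (T; if_then_else_; true; false)
open import Data.Empty using (⊥-elim)
open import Data.Fin.Base using (Fin; zero; suc; toℕ)
open import Data.Fin.Permutation using (Permutation′; permutation)
import Data.Fin.Properties as Fin
open import Data.Nat.Base as ℕ using (ℕ; zero; suc; _<_; _≤_; _<ᵇ_; _≡ᵇ_; s≤s; z≤n)
import Data.Nat.Properties as ℕ
open import Data.Product using (∃; ∃!; _×_; proj₁; proj₂)
open import Data.Vec.Functional using (Vector; head; tail; _∷_; [])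
open import Function.Base using (_∘_)
open import Function.Bundles using (module Inverse)
open import Function.Construct.Composition using (bijective)
open import Function.Definitions using (Bijective)
open import Relation.Binary.Definitions using (Decidable)
open import Relation.Binary.PropositionalEquality as ≡ using (_≡_; _≢_)
import Relation.Binary.Reasoning.Setoid as ≈-Reasoning
open import Relation.Nullary using (¬_; Dec; yes; no; contradiction)
open import Relation.Unary using (_∈_)
open import Defs

-- Sums with at most one nontrivial term.

module _ {a ℓ} (M : Monoid a ℓ) where
  open Monoid M
  open MonoidSum M

  sum-ε : ∀ {n} (t : Vector Carrier n) → (∀ i → t i ≈ ε) → sum t ≈ ε
  sum-ε {n} t t≈ε = trans (sum-cong-≋ {n} t≈ε) (sum-replicate-zero n)

  sum-single : ∀ {n} (t : Vector Carrier n) i → (∀ j → j ≢ i → t j ≈ ε) → sum t ≈ t i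
  sum-single t zero    t≈ε =
    trans (∙-congˡ (sum-ε (tail t) λ j → t≈ε (suc j) λ ())) (identityʳ _)
  sum-single t (suc i) t≈ε = trans
    (∙-cong (t≈ε zero λ ())
            (sum-single (tail t) i λ j j≢i → t≈ε (suc j) (j≢i ∘ Fin.suc-injective)))
    (identityˡ _)

-- Evaluation and synthetic division of polynomials of any length.

module FieldPolynomials {c ℓ₁ ℓ₂} (F : HeytingField c ℓ₁ ℓ₂) where

  heytingCommutativeRing : HeytingCommutativeRing c ℓ₁ ℓ₂
  heytingCommutativeRing = HeytingField.heytingCommutativeRing F

  open CommutativeRing (HeytingCommutativeRing.commutativeRing heytingCommutativeRing) public
    hiding (zero)
  open SemiringSum semiring public
  open Exp semiring public
  open ≈-Reasoning setoid public
  open AbelianGroupProperties +-abelianGroup public using (x∙y⁻¹≈ε⇒x≈y; identityˡ-unique)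
  module *-Semigroup = CommutativeSemigroupProperties *-commutativeSemigroup

  1≉0 : ¬ 1# ≈ 0#
  1≉0 1≈0 = HeytingField.#-irrefl F 1≈0
    (HeytingProperties.1#0 heytingCommutativeRing)

  invertible⇒cancelˡ : ∀ {x x⁻¹} → x * x⁻¹ ≈ 1# → ∀ {y z} → x * y ≈ x * z → y ≈ z
  invertible⇒cancelˡ {x} {x⁻¹} xx⁻¹≈1 {y} {z} xy≈xz =
    trans (sym (unfold y)) (trans (*-congˡ xy≈xz) (unfold z))
    where
    unfold : ∀ y → x⁻¹ * (x * y) ≈ y
    unfold y = begin
      x⁻¹ * (x * y) ≈⟨ *-assoc x⁻¹ x y ⟨
      (x⁻¹ * x) * y ≈⟨ *-congʳ (trans (*-comm x⁻¹ x) xx⁻¹≈1) ⟩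
      1# * y        ≈⟨ *-identityˡ y ⟩
      y             ∎

  evalₙ : ∀ {n} → Vector Carrier n → Carrier → Carrier
  evalₙ g s = sum λ i → g i * s ^ toℕ i

  module _ {n : ℕ} where

    evalₙ-cong : ∀ {g h : Vector Carrier n} {s t} → (∀ i → g i ≈ h i) → s ≈ t →
                 evalₙ g s ≈ evalₙ h t
    evalₙ-cong g≈h s≈t = sum-cong-≋ {n} λ i → *-cong (g≈h i) (^-congˡ (toℕ i) s≈t)

    evalₙ-+ : ∀ (g h : Vector Carrier n) s →
              evalₙ (λ i → g i + h i) s ≈ evalₙ g s + evalₙ h s
    evalₙ-+ g h s = trans (sum-cong-≋ {n} λ i → distribʳ (s ^ toℕ i) (g i) (h i))
                          (∑-distrib-+ {n} (λ i → g i * s ^ toℕ i) (λ i → h i * s ^ toℕ i))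

    evalₙ-* : ∀ x (g : Vector Carrier n) s → evalₙ (λ i → x * g i) s ≈ x * evalₙ g s
    evalₙ-* x g s = trans (sum-cong-≋ {n} λ i → *-assoc x (g i) (s ^ toℕ i))
                          (sym (*-distribˡ-sum {n} x λ i → g i * s ^ toℕ i))

    evalₙ-sum : ∀ {m} (g : Fin m → Vector Carrier n) s →
                evalₙ (λ k → sum λ i → g i k) s ≈ sum λ i → evalₙ (g i) s
    evalₙ-sum {m} g s = trans
      (sum-cong-≋ {n} λ k → *-distribʳ-sum {m} (s ^ toℕ k) λ i → g i k)
      (∑-comm {n} {m} λ k i → g i k * s ^ toℕ k)

    -- The product modulo x^q - x and, after reassociation, the substitution f[g,h] have
    -- coefficients of this shape, so one interchange of sums computes the values of both.
    evalₙ-∑∑ : ∀ {m m′} (x : Fin m → Fin m′ → Carrier)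
               (g : Fin m → Fin m′ → Vector Carrier n) s →
               evalₙ (λ k → sum λ i → sum λ j → x i j * g i j k) s ≈
               sum λ i → sum λ j → x i j * evalₙ (g i j) s
    evalₙ-∑∑ {m} {m′} x g s = trans
      (evalₙ-sum (λ i k → sum λ j → x i j * g i j k) s)
      (sum-cong-≋ {m} λ i → trans
        (evalₙ-sum (λ j k → x i j * g i j k) s)
        (sum-cong-≋ {m′} λ j → evalₙ-* (x i j) (g i j) s))

    evalₙ-0 : ∀ (g : Vector Carrier n) s → (∀ i → g i ≈ 0#) → evalₙ g s ≈ 0#
    evalₙ-0 g s g≈0 = sum-ε +-monoid _ λ i → trans (*-congʳ (g≈0 i)) (zeroˡ _)

    horner : ∀ (g : Vector Carrier (suc n)) s →
             evalₙ g s ≈ head g + s * evalₙ (tail g) s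
    horner g s = +-cong (*-identityʳ (head g)) (trans
      (sum-cong-≋ {n} λ i → *-Semigroup.x∙yz≈y∙xz (g (suc i)) s (s ^ toℕ i))
      (sym (*-distribˡ-sum {n} s λ i → g (suc i) * s ^ toℕ i)))

    -- Once the higher coefficients vanish, g is the constant `head g`, which is then its value at
    -- s.
    root⇒zero : ∀ (g : Vector Carrier (suc n)) s → evalₙ g s ≈ 0# →
                (∀ i → tail g i ≈ 0#) → ∀ i → g i ≈ 0#
    root⇒zero g s g[s]≈0 tail≈0 (suc i) = tail≈0 i
    root⇒zero g s g[s]≈0 tail≈0 zero    = begin
      head g                        ≈⟨ +-identityʳ (head g) ⟨
      head g + 0#                   ≈⟨ +-congˡ (zeroʳ s) ⟨
      head g + s * 0#               ≈⟨ +-congˡ (*-congˡ (evalₙ-0 (tail g) s tail≈0)) ⟨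
      head g + s * evalₙ (tail g) s ≈⟨ horner g s ⟨
      evalₙ g s                     ≈⟨ g[s]≈0 ⟩
      0#                            ∎

  -- Synthetic division of g by x - a.
  quotient : ∀ {n} → Vector Carrier (suc n) → Carrier → Vector Carrier n
  quotient {zero}  g a = []
  quotient {suc n} g a = evalₙ (tail g) a ∷ quotient (tail g) a

  -- g(s) = g(a) + (s - a) * quotient(s), with s = a + d so that no subtraction
  -- occurs and the semiring solver applies.
  evalₙ-quotient : ∀ {n} (g : Vector Carrier (suc n)) a d →
    evalₙ g (a + d) ≈ evalₙ g a + d * evalₙ (quotient g a) (a + d)
  evalₙ-quotient {zero}  g a d = sym (trans (+-congˡ (zeroʳ d)) (+-identityʳ _))
  evalₙ-quotient {suc n} g a d = begin
    evalₙ g (a + d)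
      ≈⟨ horner g (a + d) ⟩
    head g + (a + d) * evalₙ (tail g) (a + d)
      ≈⟨ +-congˡ (*-congˡ (evalₙ-quotient (tail g) a d)) ⟩
    head g + (a + d) * (e + d * e′)
      ≈⟨ rearrange (head g) a d e e′ ⟩
    (head g + a * e) + d * (e + (a + d) * e′)
      ≈⟨ +-cong (horner g a) (*-congˡ (horner (quotient g a) (a + d))) ⟨
    evalₙ g a + d * evalₙ (quotient g a) (a + d)
      ∎
    where
    e  = evalₙ (tail g) a
    e′ = evalₙ (quotient (tail g) a) (a + d)
    open SemiringSolver commutativeSemiring using (solve; _:+_; _:*_; _:=_)
    rearrange : ∀ g₀ a d e e′ →
      g₀ + (a + d) * (e + d * e′) ≈ (g₀ + a * e) + d * (e + (a + d) * e′)
    rearrange = solve 5 (λ g₀ a d e e′ →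
      g₀ :+ (a :+ d) :* (e :+ d :* e′) := (g₀ :+ a :* e) :+ d :* (e :+ (a :+ d) :* e′)) refl

  -- The entries of the quotient are the values at a of the successive proper tails of g. From the
  -- last one back, each vanishing value forces one more coefficient to vanish.
  quotient≈0⇒tail≈0 : ∀ {n} (g : Vector Carrier (suc n)) a →
    (∀ i → quotient g a i ≈ 0#) → ∀ i → tail g i ≈ 0#
  quotient≈0⇒tail≈0 {suc n} g a q≈0 =
    root⇒zero (tail g) a (q≈0 zero) (quotient≈0⇒tail≈0 (tail g) a (q≈0 ∘ suc))

-- Decidability and inverses in a field of q elements.

module FiniteField {c ℓ₁ ℓ₂} (F : HeytingField c ℓ₁ ℓ₂) {q : ℕ} (card : HasCardinality F q) where

  open FieldPolynomials F
  open Polynomials F q renaming (_⟨_⟩ to infixl 8 _⊚_)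
  open import Data.Product using (_,_)
  private
    module card = Inverse card
    module *-Sum = CommutativeMonoidSum *-commutativeMonoid
  open card using (to; from)
  open RawSemiringOps rawSemiring using () renaming (sum to ⨁; _^_ to _^ᵖ_)
  open *-Sum using () renaming (sum to product)

  infix 4 _≟_

  from∘to : ∀ x → from (to x) ≈ x
  from∘to = card.strictlyInverseʳ

  to∘from : ∀ i → to (from i) ≡ i
  to∘from = card.strictlyInverseˡ

  to-injective : ∀ {x y} → to x ≡ to y → x ≈ y
  to-injective {x} {y} eq = trans (sym (from∘to x)) (trans (card.from-cong eq) (from∘to y))

  from-injective : ∀ {i j} → from i ≈ from j → i ≡ j
  from-injective {i} {j} eq = ≡.trans (≡.sym (to∘from i)) (≡.trans (card.to-cong eq) (to∘from j))

  _≟_ : Decidable _≈_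
  x ≟ y with to x Fin.≟ to y
  ... | yes eq = yes (to-injective eq)
  ... | no ¬eq = no (¬eq ∘ card.to-cong)

  -- The elements 0 and 1 are distinct. The bound leaves room for the coefficient of x in `X` and
  -- makes the exponent q - 1 positive.
  1<q : 1 < q
  1<q = Fin.injective⇒≤ {f = λ { zero → to 0# ; (suc zero) → to 1# }} injective
    where
    injective : ∀ {i j : Fin 2} → _ ≡ _ → i ≡ j
    injective {zero}     {zero}     _  = ≡.refl
    injective {zero}     {suc zero} eq = ⊥-elim (1≉0 (sym (to-injective eq)))
    injective {suc zero} {zero}     eq = ⊥-elim (1≉0 (to-injective eq))
    injective {suc zero} {suc zero} _  = ≡.refl

  0<q : 0 < q
  0<q = ℕ.<-trans (s≤s z≤n) 1<q

  -- Constructively the inverse has to be found by search; tightness then shows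
  -- that only 0 is without one.
  ≉0⇒invertible : ∀ {x} → ¬ x ≈ 0# → ∃ λ x⁻¹ → x * x⁻¹ ≈ 1#
  ≉0⇒invertible {x} x≉0 with Fin.any? (λ i → x * from i ≟ 1#)
  ... | yes (i , eq) = from i , eq
  ... | no ∄x⁻¹ = contradiction (proj₁ (HeytingField.tight F x 0#) ¬x#0) x≉0
    where
    ¬x#0 : ¬ HeytingField._#_ F x 0#
    ¬x#0 x#0 with HeytingField.#⇒invertible F x#0
    ... | x⁻¹ , _ , eq = ∄x⁻¹ (to x⁻¹ , (begin
      x * from (to x⁻¹)  ≈⟨ *-congˡ (from∘to x⁻¹) ⟩
      x * x⁻¹            ≈⟨ *-congʳ (HeytingProperties.x-0≈x heytingCommutativeRing x) ⟨
      (x - 0#) * x⁻¹     ≈⟨ eq ⟩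
      1#                 ∎))

  *-cancelˡ-≉0 : ∀ {x y z} → ¬ x ≈ 0# → x * y ≈ x * z → y ≈ z
  *-cancelˡ-≉0 x≉0 = invertible⇒cancelˡ (proj₂ (≉0⇒invertible x≉0))

  -- The identity x^q = x and the reduction of exponents.

  product-invertible : ∀ {n} (t : Vector Carrier n) → (∀ i → ∃ λ y → t i * y ≈ 1#) →
                       ∃ λ y → product t * y ≈ 1#
  product-invertible t t-inv = product (proj₁ ∘ t-inv) , trans
    (sym (*-Sum.∑-distrib-+ t (proj₁ ∘ t-inv)))
    (sum-ε *-monoid _ (proj₂ ∘ t-inv))

  module Fermat {x : Carrier} (x≉0 : ¬ x ≈ 0#) where

    -- Replacing 0 by 1 lets the product run over the whole of F while staying invertible. `v` is
    -- the correction at y = 0: there x * u y is x, whereas u (x * y) is 1.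
    u v : Carrier → Carrier
    u y = if Dec.does (y ≟ 0#) then 1# else y
    v y = if Dec.does (y ≟ 0#) then x else 1#

    x⁻¹ : Carrier
    x⁻¹ = proj₁ (≉0⇒invertible x≉0)

    xx⁻¹≈1 : x * x⁻¹ ≈ 1#
    xx⁻¹≈1 = proj₂ (≉0⇒invertible x≉0)

    u-0 : ∀ {y} → y ≈ 0# → u y ≈ 1#
    u-0 {y} y≈0 with y ≟ 0#
    ... | yes _   = refl
    ... | no y≉0  = contradiction y≈0 y≉0

    u-≉0 : ∀ {y} → ¬ y ≈ 0# → u y ≈ y
    u-≉0 {y} y≉0 with y ≟ 0#
    ... | yes y≈0 = contradiction y≈0 y≉0
    ... | no _    = refl

    u-cong : ∀ {y z} → y ≈ z → u y ≈ u z
    u-cong {y} {z} y≈z with z ≟ 0#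
    ... | yes z≈0 = u-0 (trans y≈z z≈0)
    ... | no z≉0  = trans (u-≉0 λ y≈0 → z≉0 (trans (sym y≈z) y≈0)) y≈z

    u-invertible : ∀ y → ∃ λ z → u y * z ≈ 1#
    u-invertible y with y ≟ 0#
    ... | yes _  = 1# , *-identityˡ 1#
    ... | no y≉0 = ≉0⇒invertible y≉0

    xu≈vu : ∀ y → x * u y ≈ v y * u (x * y)
    xu≈vu y with y ≟ 0#
    ... | yes y≈0 = *-congˡ (sym (u-0 (trans (*-congˡ y≈0) (zeroʳ x))))
    ... | no y≉0  = sym (trans (*-identityˡ _)
      (u-≉0 λ xy≈0 → y≉0 (*-cancelˡ-≉0 x≉0 (trans xy≈0 (sym (zeroʳ x))))))

    product-v : product (v ∘ from) ≈ x
    product-v = trans (sum-single *-monoid (v ∘ from) (to 0#) v-≢) v-0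
      where
      v-≢ : ∀ i → i ≢ to 0# → v (from i) ≈ 1#
      v-≢ i i≢0 with from i ≟ 0#
      ... | yes eq = contradiction (≡.trans (≡.sym (to∘from i)) (card.to-cong eq)) i≢0
      ... | no _   = refl
      v-0 : v (from (to 0#)) ≈ x
      v-0 with from (to 0#) ≟ 0#
      ... | yes _ = refl
      ... | no ≉0 = contradiction (from∘to 0#) ≉0

    multiply-by : ∀ y z → y * z ≈ 1# → ∀ i → to (y * from (to (z * from i))) ≡ i
    multiply-by y z yz≈1 i = ≡.trans (card.to-cong (begin
      y * from (to (z * from i)) ≈⟨ *-congˡ (from∘to (z * from i)) ⟩
      y * (z * from i)           ≈⟨ *-assoc y z (from i) ⟨
      (y * z) * from i           ≈⟨ *-congʳ yz≈1 ⟩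
      1# * from i                ≈⟨ *-identityˡ (from i) ⟩
      from i                     ∎)) (to∘from i)

    π : Permutation′ q
    π = permutation (λ i → to (x * from i)) (λ i → to (x⁻¹ * from i))
          (multiply-by x x⁻¹ xx⁻¹≈1) (multiply-by x⁻¹ x (trans (*-comm x⁻¹ x) xx⁻¹≈1))

    U : Carrier
    U = product (u ∘ from)

    -- Each of the q factors u y absorbs one x. By `xu≈vu` this turns u y into u (x * y), except for
    -- a single x left over from y = 0, and multiplication by x only permutes the factors.
    x^q*U≈x*U : x ^ q * U ≈ x * U
    x^q*U≈x*U = begin
      x ^ q * U
        ≈⟨ *-congʳ (*-Sum.sum-replicate q) ⟨
      product {q} (λ _ → x) * U
        ≈⟨ *-Sum.∑-distrib-+ {q} (λ _ → x) (u ∘ from) ⟨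
      product {q} (λ i → x * u (from i))
        ≈⟨ *-Sum.sum-cong-≋ {q} (λ i → xu≈vu (from i)) ⟩
      product {q} (λ i → v (from i) * u (x * from i))
        ≈⟨ *-Sum.∑-distrib-+ {q} (v ∘ from) (λ i → u (x * from i)) ⟩
      product (v ∘ from) * product {q} (λ i → u (x * from i))
        ≈⟨ *-cong product-v (*-Sum.sum-cong-≋ {q} λ i → u-cong (sym (from∘to (x * from i)))) ⟩
      x * product {q} (λ i → u (from (to (x * from i))))
        ≈⟨ *-congˡ (*-Sum.sum-permute {q} {q} (u ∘ from) π) ⟨
      x * U
        ∎

    x^q≈x : x ^ q ≈ x
    x^q≈x = invertible⇒cancelˡ
      (proj₂ (product-invertible (u ∘ from) (u-invertible ∘ from)))
      (trans (*-comm U _) (trans x^q*U≈x*U (*-comm x U)))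

  x≈0⇒x^n≈0 : ∀ {x n} → x ≈ 0# → 0 < n → x ^ n ≈ 0#
  x≈0⇒x^n≈0 {n = suc n} x≈0 _ = trans (*-congʳ x≈0) (zeroˡ _)

  x^q≈x : ∀ x → x ^ q ≈ x
  x^q≈x x with x ≟ 0#
  ... | yes x≈0 = trans (x≈0⇒x^n≈0 x≈0 0<q) (sym x≈0)
  ... | no x≉0  = Fermat.x^q≈x x≉0

  q≡1+[q∸1] : q ≡ suc (q ℕ.∸ 1)
  q≡1+[q∸1] = ≡.sym (ℕ.m+[n∸m]≡n 0<q)

  x^[q∸1]≈1 : ∀ {x} → ¬ x ≈ 0# → x ^ (q ℕ.∸ 1) ≈ 1#
  x^[q∸1]≈1 {x} x≉0 = *-cancelˡ-≉0 x≉0 (begin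
    x ^ suc (q ℕ.∸ 1) ≈⟨ ^-congʳ x q≡1+[q∸1] ⟨
    x ^ q             ≈⟨ x^q≈x x ⟩
    x                 ≈⟨ *-identityʳ x ⟨
    x * 1#            ∎)

  -- For n = q + k the factor s^q becomes s, leaving s^(1 + k). Subtracting q - 1 rather than q
  -- keeps the exponent positive, so the identity also holds at s = 0.
  ^-reduceExponent : ∀ s n → s ^ reduceExponent n ≈ s ^ n
  ^-reduceExponent s n with n <ᵇ q in n<ᵇq
  ... | true  = refl
  ... | false = begin
    s ^ (n ℕ.∸ (q ℕ.∸ 1)) ≈⟨ ^-congʳ s n∸[q∸1]≡1+k ⟩
    s * s ^ k             ≈⟨ *-congʳ (x^q≈x s) ⟨
    s ^ q * s ^ k         ≈⟨ ^-homo-* s q k ⟨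
    s ^ (q ℕ.+ k)         ≈⟨ ^-congʳ s q+k≡n ⟩
    s ^ n                 ∎
    where
    k = n ℕ.∸ q
    q≤n : q ≤ n
    q≤n = ℕ.≮⇒≥ λ n<q → ≡.subst T n<ᵇq (ℕ.<⇒<ᵇ n<q)
    q+k≡n : q ℕ.+ k ≡ n
    q+k≡n = ℕ.m+[n∸m]≡n q≤n
    n∸[q∸1]≡1+k : n ℕ.∸ (q ℕ.∸ 1) ≡ suc k
    n∸[q∸1]≡1+k = ≡.trans
      (≡.cong (ℕ._∸ (q ℕ.∸ 1)) (≡.trans (≡.sym q+k≡n) (≡.trans
        (≡.cong (ℕ._+ k) q≡1+[q∸1]) (≡.sym (ℕ.+-suc (q ℕ.∸ 1) k)))))
      (ℕ.m+n∸m≡n (q ℕ.∸ 1) (suc k))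

  -- Both i and j are at most q - 1, so one subtraction of q - 1 leaves at most q - 1.
  reduceExponent-< : ∀ (i j : Fin q) → reduceExponent (toℕ i ℕ.+ toℕ j) < q
  reduceExponent-< i j with toℕ i ℕ.+ toℕ j <ᵇ q in i+j<ᵇq
  ... | true  = ℕ.<ᵇ⇒< _ _ (≡.subst T (≡.sym i+j<ᵇq) _)
  ... | false = ≡.subst (toℕ i ℕ.+ toℕ j ℕ.∸ (q ℕ.∸ 1) <_) (≡.sym q≡1+[q∸1])
    (s≤s (ℕ.m≤n+o⇒m∸n≤o _ _ (ℕ.+-mono-≤ (ℕ.<⇒≤pred (Fin.toℕ<n i)) (ℕ.<⇒≤pred (Fin.toℕ<n j)))))

  -- Values of sums, products, powers and composites.

  eval-cong : ∀ {g h s t} → g ≋ h → s ≈ t → eval g s ≈ eval h t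
  eval-cong = evalₙ-cong

  -- The weights are a function on ℕ, not on `Fin m`, so that the induction can shift them together
  -- with n.
  sum-monomial : ∀ {m n} (t : ℕ → Carrier) → n < m →
    sum {m} (λ k → (if n ≡ᵇ toℕ k then 1# else 0#) * t (toℕ k)) ≈ t n
  sum-monomial {suc m} {zero}  t _         = trans
    (+-cong (*-identityˡ _) (sum-ε +-monoid {m} _ λ k → zeroˡ _)) (+-identityʳ _)
  sum-monomial {suc m} {suc n} t (s≤s n<m) = trans
    (+-cong (zeroˡ _) (sum-monomial (t ∘ suc) n<m)) (+-identityˡ _)

  eval-monomial : ∀ {n} → n < q → ∀ s → eval (monomial n) s ≈ s ^ n
  eval-monomial n<q s = sum-monomial (s ^_) n<q

  eval-C : ∀ x s → eval (C x) s ≈ x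
  eval-C x s = begin
    eval (C x) s            ≈⟨ evalₙ-* x (monomial 0) s ⟩
    x * eval (monomial 0) s ≈⟨ *-congˡ (eval-monomial 0<q s) ⟩
    x * 1#                  ≈⟨ *-identityʳ x ⟩
    x                       ∎

  eval-X : ∀ s → eval X s ≈ s
  eval-X s = trans (eval-monomial 1<q s) (*-identityʳ s)

  eval-⊕ : ∀ g h s → eval (g ⊕ h) s ≈ eval g s + eval h s
  eval-⊕ = evalₙ-+

  eval-⊕C : ∀ g x s → eval (g ⊕ C x) s ≈ eval g s + x
  eval-⊕C g x s = trans (eval-⊕ g (C x) s) (+-congˡ (eval-C x s))

  eval-X⊕C : ∀ x s → eval (X ⊕ C x) s ≈ s + x
  eval-X⊕C x s = trans (eval-⊕C X x s) (+-congʳ (eval-X s))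

  -- Reducing an exponent does not alter the value of a power, so the double sum factors as for
  -- ordinary polynomials.
  eval-⊗ : ∀ g h s → eval (g ⊗ h) s ≈ eval g s * eval h s
  eval-⊗ g h s = begin
    eval (g ⊗ h) s
      ≈⟨ evalₙ-∑∑ {q} {q} {q} (λ i j → g i * h j)
           (λ i j → monomial (reduceExponent (toℕ i ℕ.+ toℕ j))) s ⟩
    sum {q} (λ i → sum {q} λ j → (g i * h j) * eval (monomial (reduceExponent (toℕ i ℕ.+ toℕ j))) s)
      ≈⟨ sum-cong-≋ {q} (λ i → sum-cong-≋ {q} (λ j → *-congˡ {g i * h j} (power i j))) ⟩
    sum {q} (λ i → sum {q} λ j → (g i * h j) * (s ^ toℕ i * s ^ toℕ j))
      ≈⟨ sum-cong-≋ {q} (λ i → sum-cong-≋ {q} (λ j →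
           *-Semigroup.interchange (g i) (h j) (s ^ toℕ i) (s ^ toℕ j))) ⟩
    sum {q} (λ i → sum {q} λ j → (g i * s ^ toℕ i) * (h j * s ^ toℕ j))
      ≈⟨ sum-cong-≋ {q} (λ i → *-distribˡ-sum {q} (g i * s ^ toℕ i) (λ j → h j * s ^ toℕ j)) ⟨
    sum {q} (λ i → (g i * s ^ toℕ i) * eval h s)
      ≈⟨ *-distribʳ-sum {q} (eval h s) (λ i → g i * s ^ toℕ i) ⟨
    eval g s * eval h s
      ∎
    where
    power : ∀ i j → eval (monomial (reduceExponent (toℕ i ℕ.+ toℕ j))) s ≈ s ^ toℕ i * s ^ toℕ j
    power i j = begin
      eval (monomial (reduceExponent (toℕ i ℕ.+ toℕ j))) s
        ≈⟨ eval-monomial (reduceExponent-< i j) s ⟩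
      s ^ reduceExponent (toℕ i ℕ.+ toℕ j)
        ≈⟨ ^-reduceExponent s (toℕ i ℕ.+ toℕ j) ⟩
      s ^ (toℕ i ℕ.+ toℕ j)
        ≈⟨ ^-homo-* s (toℕ i) (toℕ j) ⟩
      s ^ toℕ i * s ^ toℕ j
        ∎

  eval-^ : ∀ g n s → eval (g ^ᵖ n) s ≈ eval g s ^ n
  eval-^ g zero    s = eval-C 1# s
  eval-^ g (suc n) s = trans (eval-⊗ g (g ^ᵖ n) s) (*-congˡ (eval-^ g n s))

  eval-⨁ : ∀ {n} (g : Vector Poly n) s → eval (⨁ g) s ≈ sum λ i → eval (g i) s
  eval-⨁ {zero}  g s = eval-C 0# s
  eval-⨁ {suc n} g s = trans (eval-⊕ (head g) (⨁ (tail g)) s) (+-congˡ (eval-⨁ (tail g) s))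

  eval-⊚ : ∀ g h s → eval (g ⊚ h) s ≈ eval g (eval h s)
  eval-⊚ g h s = trans (eval-⨁ (λ i → C (g i) ⊗ h ^ᵖ toℕ i) s) (sum-cong-≋ {q} λ i → begin
    eval (C (g i) ⊗ h ^ᵖ toℕ i) s          ≈⟨ eval-⊗ (C (g i)) (h ^ᵖ toℕ i) s ⟩
    eval (C (g i)) s * eval (h ^ᵖ toℕ i) s ≈⟨ *-cong (eval-C (g i) s) (eval-^ h (toℕ i) s) ⟩
    g i * eval h s ^ toℕ i                 ∎)

  eval-⟨,⟩ : ∀ f g h s → eval (f ⟨ g , h ⟩) s ≈ eval₂ f (eval g s) (eval h s)
  eval-⟨,⟩ f g h s = trans (eval-⨁ (λ i → ⨁ (term i)) s) (sum-cong-≋ {q} λ i →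
    trans (eval-⨁ (term i) s) (sum-cong-≋ {q} λ j → eval-term i j))
    where
    term : Fin q → Fin q → Poly
    term i j = C (f i j) ⊗ (g ^ᵖ toℕ i ⊗ h ^ᵖ toℕ j)
    eval-term : ∀ i j →
      eval (term i j) s ≈ f i j * (eval g s ^ toℕ i * eval h s ^ toℕ j)
    eval-term i j = begin
      eval (term i j) s
        ≈⟨ eval-⊗ (C (f i j)) (g ^ᵖ toℕ i ⊗ h ^ᵖ toℕ j) s ⟩
      eval (C (f i j)) s * eval (g ^ᵖ toℕ i ⊗ h ^ᵖ toℕ j) s
        ≈⟨ *-cong (eval-C (f i j) s) (eval-⊗ (g ^ᵖ toℕ i) (h ^ᵖ toℕ j) s) ⟩
      f i j * (eval (g ^ᵖ toℕ i) s * eval (h ^ᵖ toℕ j) s)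
        ≈⟨ *-congˡ (*-cong (eval-^ g (toℕ i) s) (eval-^ h (toℕ j) s)) ⟩
      f i j * (eval g s ^ toℕ i * eval h s ^ toℕ j)
        ∎

  eval₂-cong : ∀ f {s s′ t t′} → s ≈ s′ → t ≈ t′ → eval₂ f s t ≈ eval₂ f s′ t′
  eval₂-cong f s≈s′ t≈t′ = sum-cong-≋ {q} λ i → sum-cong-≋ {q} λ j →
    *-congˡ (*-cong (^-congˡ (toℕ i) s≈s′) (^-congˡ (toℕ j) t≈t′))

  -- Reads f as a polynomial in x whose coefficients are the values at t of polynomials in y, which
  -- brings statements in two variables down to one.
  eval₂-iterated : ∀ f s t → eval₂ f s t ≈ eval (λ i → eval (f i) t) s
  eval₂-iterated f s t = sum-cong-≋ {q} λ i → trans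
    (sum-cong-≋ {q} λ j → *-Semigroup.x∙yz≈xz∙y (f i j) (s ^ toℕ i) (t ^ toℕ j))
    (sym (*-distribʳ-sum {q} (s ^ toℕ i) λ j → f i j * t ^ toℕ j))

  -- With m fixed, the sum over the powers of y is taken first (`inner`), which collects the powers
  -- of h into their values at t. The sum over the powers of x then does the same for g at s.
  eval₂-[,] : ∀ f g h s t → eval₂ (f [ g , h ]) s t ≈ eval₂ f (eval g s) (eval h t)
  eval₂-[,] f g h s t = begin
    eval₂ (f [ g , h ]) s t
      ≈⟨ eval₂-iterated (f [ g , h ]) s t ⟩
    eval (λ m → eval ((f [ g , h ]) m) t) s
      ≈⟨ evalₙ-cong {q} inner refl ⟩
    eval (λ m → sum {q} λ i → sum {q} λ j → (f i j * eval (H j) t) * G i m) s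
      ≈⟨ evalₙ-∑∑ {q} {q} {q} (λ i j → f i j * eval (H j) t) (λ i j → G i) s ⟩
    sum {q} (λ i → sum {q} λ j → (f i j * eval (H j) t) * eval (G i) s)
      ≈⟨ sum-cong-≋ {q} (λ i → sum-cong-≋ {q} (λ j → begin
           (f i j * eval (H j) t) * eval (G i) s
             ≈⟨ *-Semigroup.x∙yz≈xz∙y (f i j) (eval (G i) s) (eval (H j) t) ⟨
           f i j * (eval (G i) s * eval (H j) t)
             ≈⟨ *-congˡ (*-cong (eval-^ g (toℕ i) s) (eval-^ h (toℕ j) t)) ⟩
           f i j * (eval g s ^ toℕ i * eval h t ^ toℕ j)
             ∎)) ⟩
    eval₂ f (eval g s) (eval h t)
      ∎
    where
    G H : Fin q → Poly
    G i = g ^ᵖ toℕ i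
    H j = h ^ᵖ toℕ j
    inner : ∀ m → eval ((f [ g , h ]) m) t ≈
                  sum {q} λ i → sum {q} λ j → (f i j * eval (H j) t) * G i m
    inner m = begin
      eval (λ n → sum {q} λ i → sum {q} λ j → f i j * (G i m * H j n)) t
        ≈⟨ evalₙ-cong {q} (λ n → sum-cong-≋ {q} λ i → sum-cong-≋ {q} λ j →
             sym (*-assoc (f i j) (G i m) (H j n))) refl ⟩
      eval (λ n → sum {q} λ i → sum {q} λ j → (f i j * G i m) * H j n) t
        ≈⟨ evalₙ-∑∑ {q} {q} {q} (λ i j → f i j * G i m) (λ i j → H j) t ⟩
      sum {q} (λ i → sum {q} λ j → (f i j * G i m) * eval (H j) t)
        ≈⟨ sum-cong-≋ {q} (λ i → sum-cong-≋ {q} (λ j →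
             *-Semigroup.xy∙z≈xz∙y (f i j) (G i m) (eval (H j) t))) ⟩
      sum {q} (λ i → sum {q} λ j → (f i j * eval (H j) t) * G i m)
        ∎

  -- Polynomials of degree less than q are determined by their values.

  roots⇒zero : ∀ {n} (g : Vector Carrier n) (y : Fin n → Carrier) →
    (∀ {i j} → y i ≈ y j → i ≡ j) → (∀ i → evalₙ g (y i) ≈ 0#) → ∀ i → g i ≈ 0#
  -- The quotient by x - a has one coefficient fewer and keeps the remaining roots, so it vanishes
  -- by induction. Then g is constant, and its root a makes it zero.
  roots⇒zero {suc n} g y y-injective g[y]≈0 =
    root⇒zero g a (g[y]≈0 zero) (quotient≈0⇒tail≈0 g a
      (roots⇒zero (quotient g a) (y ∘ suc) (Fin.suc-injective ∘ y-injective) quotient[y]≈0))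
    where
    a = y zero
    quotient[y]≈0 : ∀ i → evalₙ (quotient g a) (y (suc i)) ≈ 0#
    -- In g(s) = g(a) + d * quotient(s) both values of g are zero, and d can be cancelled because s
    -- and a are distinct.
    quotient[y]≈0 i = *-cancelˡ-≉0 d≉0 (begin
      d * evalₙ (quotient g a) s
        ≈⟨ *-congˡ (evalₙ-cong {n} (λ _ → refl) a+d≈s) ⟨
      d * evalₙ (quotient g a) (a + d)
        ≈⟨ +-identityˡ _ ⟨
      0# + d * evalₙ (quotient g a) (a + d)
        ≈⟨ +-congʳ (g[y]≈0 zero) ⟨
      evalₙ g a + d * evalₙ (quotient g a) (a + d)
        ≈⟨ evalₙ-quotient g a d ⟨
      evalₙ g (a + d)
        ≈⟨ evalₙ-cong {suc n} {g} (λ _ → refl) a+d≈s ⟩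
      evalₙ g s
        ≈⟨ g[y]≈0 (suc i) ⟩
      0#
        ≈⟨ zeroʳ d ⟨
      d * 0#
        ∎)
      where
      s = y (suc i)
      d = s - a
      d≉0 : ¬ d ≈ 0#
      d≉0 d≈0 with () ← y-injective (x∙y⁻¹≈ε⇒x≈y s a d≈0)
      a+d≈s : a + d ≈ s
      a+d≈s = begin
        a + (s - a)   ≈⟨ +-comm a (s - a) ⟩
        (s - a) + a   ≈⟨ +-assoc s (- a) a ⟩
        s + (- a + a) ≈⟨ +-congˡ (-‿inverseˡ a) ⟩
        s + 0#        ≈⟨ +-identityʳ s ⟩
        s             ∎

  -- The difference has q coefficients and vanishes at all q elements of F.
  eval-injective : ∀ {g h} → (∀ s → eval g s ≈ eval h s) → g ≋ h
  eval-injective {g} {h} g≈h i = x∙y⁻¹≈ε⇒x≈y (g i) (h i)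
    (roots⇒zero (λ i → g i - h i) from from-injective (λ j → difference (from j)) i)
    where
    difference : ∀ s → eval (λ i → g i - h i) s ≈ 0#
    difference s = identityˡ-unique _ (eval h s) (begin
      eval (λ i → g i - h i) s + eval h s
        ≈⟨ evalₙ-+ {q} (λ i → g i - h i) h s ⟨
      eval (λ i → g i - h i + h i) s
        ≈⟨ evalₙ-cong {q} (λ i → trans (+-assoc (g i) (- h i) (h i))
             (trans (+-congˡ (-‿inverseˡ (h i))) (+-identityʳ (g i)))) refl ⟩
      eval g s
        ≈⟨ g≈h s ⟩
      eval h s
        ∎)

  -- For fixed t the coefficients in x agree. These are the values at t of polynomials in y, so the
  -- argument applies a second time.
  eval₂-injective : ∀ {f f′} → (∀ s t → eval₂ f s t ≈ eval₂ f′ s t) → f ≋₂ f′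
  eval₂-injective {f} {f′} f≈f′ i = eval-injective λ t → eval-injective
    (λ s → trans (sym (eval₂-iterated f s t)) (trans (f≈f′ s t) (eval₂-iterated f′ s t))) i

  -- Interpolation over the whole field.

  indicator : Carrier → Poly
  indicator a = C 1# ⊕ C (- 1#) ⊗ (X ⊕ C (- a)) ^ᵖ (q ℕ.∸ 1)

  eval-indicator : ∀ a s → eval (indicator a) s ≈ 1# + - 1# * (s - a) ^ (q ℕ.∸ 1)
  eval-indicator a s = begin
    eval (indicator a) s
      ≈⟨ eval-⊕ (C 1#) _ s ⟩
    eval (C 1#) s + eval (C (- 1#) ⊗ (X ⊕ C (- a)) ^ᵖ (q ℕ.∸ 1)) s
      ≈⟨ +-cong (eval-C 1# s) (eval-⊗ (C (- 1#)) _ s) ⟩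
    1# + eval (C (- 1#)) s * eval ((X ⊕ C (- a)) ^ᵖ (q ℕ.∸ 1)) s
      ≈⟨ +-congˡ (*-cong (eval-C (- 1#) s) (eval-^ (X ⊕ C (- a)) (q ℕ.∸ 1) s)) ⟩
    1# + - 1# * eval (X ⊕ C (- a)) s ^ (q ℕ.∸ 1)
      ≈⟨ +-congˡ (*-congˡ (^-congˡ (q ℕ.∸ 1) (eval-X⊕C (- a) s))) ⟩
    1# + - 1# * (s - a) ^ (q ℕ.∸ 1)
      ∎

  eval-indicator-≈ : ∀ {a s} → s ≈ a → eval (indicator a) s ≈ 1#
  eval-indicator-≈ {a} {s} s≈a = begin
    eval (indicator a) s            ≈⟨ eval-indicator a s ⟩
    -- `1<q` makes the exponent positive; with exponent 0 the power would be 1.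
    1# + - 1# * (s - a) ^ (q ℕ.∸ 1) ≈⟨ +-congˡ (*-congˡ (x≈0⇒x^n≈0 s-a≈0 (ℕ.m<n⇒0<n∸m 1<q))) ⟩
    1# + - 1# * 0#                  ≈⟨ +-congˡ (zeroʳ (- 1#)) ⟩
    1# + 0#                         ≈⟨ +-identityʳ 1# ⟩
    1#                              ∎
    where
    s-a≈0 : s - a ≈ 0#
    s-a≈0 = trans (+-congʳ s≈a) (-‿inverseʳ a)

  eval-indicator-≉ : ∀ {a s} → ¬ s ≈ a → eval (indicator a) s ≈ 0#
  eval-indicator-≉ {a} {s} s≉a = begin
    eval (indicator a) s            ≈⟨ eval-indicator a s ⟩
    1# + - 1# * (s - a) ^ (q ℕ.∸ 1) ≈⟨ +-congˡ (*-congˡ (x^[q∸1]≈1 (s≉a ∘ x∙y⁻¹≈ε⇒x≈y s a))) ⟩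
    1# + - 1# * 1#                  ≈⟨ +-congˡ (*-identityʳ (- 1#)) ⟩
    1# + - 1#                       ≈⟨ -‿inverseʳ 1# ⟩
    0#                              ∎

  interpolate : (Carrier → Carrier) → Poly
  interpolate φ = ⨁ {q} λ i → C (φ (from i)) ⊗ indicator (from i)

  -- Only the summand with index `to s` survives. There φ is taken at `from (to s)`, which is merely
  -- equivalent to s, so φ has to respect the equivalence.
  eval-interpolate : ∀ φ → (∀ {x y} → x ≈ y → φ x ≈ φ y) → ∀ s → eval (interpolate φ) s ≈ φ s
  eval-interpolate φ φ-cong s = begin
    eval (interpolate φ) s
      ≈⟨ eval-⨁ {q} (λ i → C (φ (from i)) ⊗ indicator (from i)) s ⟩
    sum {q} (λ i → eval (C (φ (from i)) ⊗ indicator (from i)) s)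
      ≈⟨ sum-cong-≋ {q} (λ i → trans (eval-⊗ (C (φ (from i))) (indicator (from i)) s)
           (*-congʳ (eval-C (φ (from i)) s))) ⟩
    sum {q} (λ i → φ (from i) * eval (indicator (from i)) s)
      ≈⟨ sum-single +-monoid {q} _ (to s) (λ i i≢s → trans
           (*-congˡ (eval-indicator-≉ λ s≈i → i≢s
             (≡.trans (≡.sym (to∘from i)) (card.to-cong (sym s≈i)))))
           (zeroʳ _)) ⟩
    φ (from (to s)) * eval (indicator (from (to s))) s
      ≈⟨ *-cong (φ-cong (from∘to s)) (eval-indicator-≈ (sym (from∘to s))) ⟩
    φ s * 1#
      ≈⟨ *-identityʳ (φ s) ⟩
    φ s
      ∎

  -- Permutation polynomials and their inverses.

  Bij : (Carrier → Carrier) → Set _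
  Bij = Bijective _≈_ _≈_

  -- Transfers membership in `𝓟`, a property of values, to and from explicit formulas for these
  -- values.
  bijective-resp : ∀ {φ ψ} → (∀ s → φ s ≈ ψ s) → Bij φ → Bij ψ
  bijective-resp φ≈ψ (injective , surjective) =
    (λ {x} {y} ψx≈ψy → injective (trans (φ≈ψ x) (trans ψx≈ψy (sym (φ≈ψ y))))) ,
    (λ y → proj₁ (surjective y) , λ {z} z≈x →
      trans (sym (φ≈ψ z)) (proj₂ (surjective y) z≈x))

  translation-bijective : ∀ a → Bij (_+ a)
  translation-bijective a = injective , λ y → y - a , λ {z} z≈y-a → begin
      z + a         ≈⟨ +-congʳ z≈y-a ⟩
      (y - a) + a   ≈⟨ +-assoc y (- a) a ⟩
      y + (- a + a) ≈⟨ +-congˡ (-‿inverseˡ a) ⟩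
      y + 0#        ≈⟨ +-identityʳ y ⟩
      y             ∎
    where
    injective : ∀ {x y} → x + a ≈ y + a → x ≈ y
    injective {x} {y} = AbelianGroupProperties.∙-cancelʳ +-abelianGroup a x y

  𝓟-⊕C : ∀ {g} a → g ∈ 𝓟 → g ⊕ C a ∈ 𝓟
  𝓟-⊕C {g} a g∈𝓟 = bijective-resp (λ s → sym (eval-⊕C g a s))
    (bijective _≈_ _≈_ _≈_ g∈𝓟 (translation-bijective a))

  eval-inverseʳ : ∀ {g g⁻¹} → g⁻¹ IsInverseOf g → ∀ s → eval g (eval g⁻¹ s) ≈ s
  eval-inverseʳ {g} {g⁻¹} (_ , gg⁻¹≋X , _) s = begin
    eval g (eval g⁻¹ s)  ≈⟨ eval-⊚ g g⁻¹ s ⟨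
    eval (g ⊚ g⁻¹) s     ≈⟨ eval-cong gg⁻¹≋X refl ⟩
    eval X s             ≈⟨ eval-X s ⟩
    s                    ∎

  -- The preimages chosen by surjectivity are interpolated by a polynomial. Injectivity of g makes
  -- this right inverse two-sided and forces any other inverse to take the same values, hence to
  -- have the same coefficients.
  ∃!-inverse : ∀ {g} → g ∈ 𝓟 → ∃! _≋_ (_IsInverseOf g)
  ∃!-inverse {g} (g-injective , g-surjective) =
    g⁻¹ , (g⁻¹∈𝓟 , composite g g⁻¹ g∘g⁻¹ , composite g⁻¹ g g⁻¹∘g) , λ {g′} g′-inverse →
      eval-injective λ s → g-injective (trans (g∘g⁻¹ s) (sym (eval-inverseʳ g′-inverse s)))
    where
    φ : Carrier → Carrier
    φ s = proj₁ (g-surjective s)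
    g∘φ : ∀ s → eval g (φ s) ≈ s
    g∘φ s = proj₂ (g-surjective s) refl
    g⁻¹ : Poly
    g⁻¹ = interpolate φ
    eval-g⁻¹ : ∀ s → eval g⁻¹ s ≈ φ s
    -- The choice of preimages respects `_≈_` because g is injective and g(φ(s)) = s.
    eval-g⁻¹ = eval-interpolate φ λ {x} {y} x≈y →
      g-injective (trans (g∘φ x) (trans x≈y (sym (g∘φ y))))
    g∘g⁻¹ : ∀ s → eval g (eval g⁻¹ s) ≈ s
    g∘g⁻¹ s = trans (eval-cong {g} (λ _ → refl) (eval-g⁻¹ s)) (g∘φ s)
    g⁻¹∘g : ∀ s → eval g⁻¹ (eval g s) ≈ s
    g⁻¹∘g s = g-injective (g∘g⁻¹ (eval g s))
    composite : ∀ h h′ → (∀ s → eval h (eval h′ s) ≈ s) → h ⊚ h′ ≋ X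
    composite h h′ h∘h′ = eval-injective λ s →
      trans (eval-⊚ h h′ s) (trans (h∘h′ s) (sym (eval-X s)))
    g⁻¹∈𝓟 : g⁻¹ ∈ 𝓟
    g⁻¹∈𝓟 =
      (λ {x} {y} eq → trans (sym (g∘g⁻¹ x))
        (trans (eval-cong {g} (λ _ → refl) eq) (g∘g⁻¹ y))) ,
      λ y → eval g y , λ z≈gy → trans (eval-cong {g⁻¹} (λ _ → refl) z≈gy) (g⁻¹∘g y)

  -- The reduced polynomial attached to a zero (a, b) of f.

  module Reduction (f : Poly₂) (a b : Carrier) (f∈𝓛𝓟 : f ∈ 𝓛𝓟) (f[a,b]≈0 : eval₂ f a b ≈ 0#) where

    eval-XC : ∀ t s → eval (f ⟨ X , C t ⟩) s ≈ eval₂ f s t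
    eval-XC t s = trans (eval-⟨,⟩ f X (C t) s) (eval₂-cong f (eval-X s) (eval-C t s))

    eval-CX : ∀ t s → eval (f ⟨ C t , X ⟩) s ≈ eval₂ f t s
    eval-CX t s = trans (eval-⟨,⟩ f (C t) X s) (eval₂-cong f (eval-C t s) (eval-X s))

    bijectiveˡ : ∀ t → Bij (λ s → eval₂ f s t)
    bijectiveˡ t = bijective-resp (eval-XC t) (proj₁ (f∈𝓛𝓟 t))

    bijectiveʳ : ∀ t → Bij (eval₂ f t)
    bijectiveʳ t = bijective-resp (eval-CX t) (proj₂ (f∈𝓛𝓟 t))

    g h : Poly
    g = f ⟨ X ⊕ C a , C b ⟩
    h = f ⟨ C a , X ⊕ C b ⟩

    eval-g : ∀ s → eval g s ≈ eval₂ f (s + a) b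
    eval-g s = trans (eval-⟨,⟩ f (X ⊕ C a) (C b) s)
                     (eval₂-cong f (eval-X⊕C a s) (eval-C b s))

    eval-h : ∀ s → eval h s ≈ eval₂ f a (s + b)
    eval-h s = trans (eval-⟨,⟩ f (C a) (X ⊕ C b) s)
                     (eval₂-cong f (eval-C a s) (eval-X⊕C b s))

    g∈𝓟 : g ∈ 𝓟
    g∈𝓟 = bijective-resp (λ s → sym (eval-g s))
      (bijective _≈_ _≈_ _≈_ (translation-bijective a) (bijectiveˡ b))

    h∈𝓟 : h ∈ 𝓟
    h∈𝓟 = bijective-resp (λ s → sym (eval-h s))
      (bijective _≈_ _≈_ _≈_ (translation-bijective b) (bijectiveʳ a))

    module _ (g⁻¹ h⁻¹ : Poly)
             (g⁻¹-inverse : g⁻¹ IsInverseOf g) (h⁻¹-inverse : h⁻¹ IsInverseOf h) where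

      p r : Poly
      p = g⁻¹ ⊕ C a
      r = h⁻¹ ⊕ C b

      ρ : Poly₂
      ρ = f [ p , r ]

      p∈𝓟 : p ∈ 𝓟
      p∈𝓟 = 𝓟-⊕C a (proj₁ g⁻¹-inverse)

      r∈𝓟 : r ∈ 𝓟
      r∈𝓟 = 𝓟-⊕C b (proj₁ h⁻¹-inverse)

      f[p,b] : ∀ s → eval₂ f (eval p s) b ≈ s
      f[p,b] s = begin
        eval₂ f (eval p s) b       ≈⟨ eval₂-cong f (eval-⊕C g⁻¹ a s) refl ⟩
        eval₂ f (eval g⁻¹ s + a) b ≈⟨ eval-g (eval g⁻¹ s) ⟨
        eval g (eval g⁻¹ s)        ≈⟨ eval-inverseʳ g⁻¹-inverse s ⟩
        s                          ∎

      f[a,r] : ∀ s → eval₂ f a (eval r s) ≈ s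
      f[a,r] s = begin
        eval₂ f a (eval r s)       ≈⟨ eval₂-cong f refl (eval-⊕C h⁻¹ b s) ⟩
        eval₂ f a (eval h⁻¹ s + b) ≈⟨ eval-h (eval h⁻¹ s) ⟨
        eval h (eval h⁻¹ s)        ≈⟨ eval-inverseʳ h⁻¹-inverse s ⟩
        s                          ∎

      -- The map sending x to f(x, b) is injective and takes both sides to s. Taking s = 0 yields
      -- p(0) = a, and s = f(x, b) yields p(f(x, b)) = x.
      p-unique : ∀ s {x} → eval₂ f x b ≈ s → eval p s ≈ x
      p-unique s eq = proj₁ (bijectiveˡ b) (trans (f[p,b] s) (sym eq))

      r-unique : ∀ s {y} → eval₂ f a y ≈ s → eval r s ≈ y
      r-unique s eq = proj₁ (bijectiveʳ a) (trans (f[a,r] s) (sym eq))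

      eval-ρ⟨X,C⟩ : ∀ t s → eval (ρ ⟨ X , C t ⟩) s ≈ eval₂ f (eval p s) (eval r t)
      eval-ρ⟨X,C⟩ t s = begin
        eval (ρ ⟨ X , C t ⟩) s            ≈⟨ eval-⟨,⟩ ρ X (C t) s ⟩
        eval₂ ρ (eval X s) (eval (C t) s) ≈⟨ eval₂-cong ρ (eval-X s) (eval-C t s) ⟩
        eval₂ ρ s t                       ≈⟨ eval₂-[,] f p r s t ⟩
        eval₂ f (eval p s) (eval r t)     ∎

      eval-ρ⟨C,X⟩ : ∀ t s → eval (ρ ⟨ C t , X ⟩) s ≈ eval₂ f (eval p t) (eval r s)
      eval-ρ⟨C,X⟩ t s = begin
        eval (ρ ⟨ C t , X ⟩) s            ≈⟨ eval-⟨,⟩ ρ (C t) X s ⟩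
        eval₂ ρ (eval (C t) s) (eval X s) ≈⟨ eval₂-cong ρ (eval-C t s) (eval-X s) ⟩
        eval₂ ρ t s                       ≈⟨ eval₂-[,] f p r t s ⟩
        eval₂ f (eval p t) (eval r s)     ∎

      -- Fixing one variable of ρ at t gives `p` or `r` followed by a section of f, at r(t) or p(t)
      -- respectively.
      ρ∈𝓛𝓟 : ρ ∈ 𝓛𝓟
      ρ∈𝓛𝓟 t =
        bijective-resp (λ s → sym (eval-ρ⟨X,C⟩ t s))
          (bijective _≈_ _≈_ _≈_ p∈𝓟 (bijectiveˡ (eval r t))) ,
        bijective-resp (λ s → sym (eval-ρ⟨C,X⟩ t s))
          (bijective _≈_ _≈_ _≈_ r∈𝓟 (bijectiveʳ (eval p t)))

      ρ∈𝓡𝓛𝓟 : ρ ∈ 𝓡𝓛𝓟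
      ρ∈𝓡𝓛𝓟 = ρ∈𝓛𝓟 ,
        eval-injective (λ s → begin
          eval (ρ ⟨ X , C 0# ⟩) s        ≈⟨ eval-ρ⟨X,C⟩ 0# s ⟩
          -- The zero of f at (a, b) enters here, as r(0) = b.
          eval₂ f (eval p s) (eval r 0#) ≈⟨ eval₂-cong f refl (r-unique 0# f[a,b]≈0) ⟩
          eval₂ f (eval p s) b           ≈⟨ f[p,b] s ⟩
          s                              ≈⟨ eval-X s ⟨
          eval X s                       ∎) ,
        eval-injective (λ s → begin
          eval (ρ ⟨ C 0# , X ⟩) s        ≈⟨ eval-ρ⟨C,X⟩ 0# s ⟩
          eval₂ f (eval p 0#) (eval r s) ≈⟨ eval₂-cong f (p-unique 0# f[a,b]≈0) refl ⟩
          eval₂ f a (eval r s)           ≈⟨ f[a,r] s ⟩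
          s                              ≈⟨ eval-X s ⟨
          eval X s                       ∎)

      principalIsotopic : PrincipalIsotopic f ρ
      -- The definition asks for the way back from ρ to f, so the witnesses are the inverses of p
      -- and r, namely the sections f(x, b) and f(a, y).
      principalIsotopic = h₁ , h₂ , proj₁ (f∈𝓛𝓟 b) , proj₂ (f∈𝓛𝓟 a) , eval₂-injective λ s t → begin
        eval₂ (ρ [ h₁ , h₂ ]) s t
          ≈⟨ eval₂-[,] ρ h₁ h₂ s t ⟩
        eval₂ ρ (eval h₁ s) (eval h₂ t)
          ≈⟨ eval₂-[,] f p r (eval h₁ s) (eval h₂ t) ⟩
        eval₂ f (eval p (eval h₁ s)) (eval r (eval h₂ t))
          ≈⟨ eval₂-cong f (p-unique (eval h₁ s) (sym (eval-XC b s)))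
                          (r-unique (eval h₂ t) (sym (eval-CX a t))) ⟩
        eval₂ f s t
          ∎
        where
        h₁ = f ⟨ X , C b ⟩
        h₂ = f ⟨ C a , X ⟩

-- An inverse is fixed only up to `_≋_`, so the claims about ρ range over all inverses, next to the
-- existence and uniqueness of one.
proposition4p4 : ∀ {c ℓ₁ ℓ₂} (q : ℕ) → IsPrimePower q →
    (F : HeytingField c ℓ₁ ℓ₂) → HasCardinality F q →
    let open HeytingField F
        open Polynomials F q in
    (f : Poly₂) (a b : Carrier) → f ∈ 𝓛𝓟 → eval₂ f a b ≈ 0# →
    let g = f ⟨ X ⊕ C a , C b ⟩
        h = f ⟨ C a , X ⊕ C b ⟩ in
    (g ∈ 𝓟 × ∃! _≋_ (_IsInverseOf g)) ×
    (h ∈ 𝓟 × ∃! _≋_ (_IsInverseOf h)) ×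
    (∀ g⁻¹ h⁻¹ → g⁻¹ IsInverseOf g → h⁻¹ IsInverseOf h →
      let ρ = f [ g⁻¹ ⊕ C a , h⁻¹ ⊕ C b ] in
      ρ ∈ 𝓡𝓛𝓟 × PrincipalIsotopic f ρ)
proposition4p4 q _ F card f a b f∈𝓛𝓟 f[a,b]≈0 =
  (g∈𝓟 , ∃!-inverse g∈𝓟) , (h∈𝓟 , ∃!-inverse h∈𝓟) , λ g⁻¹ h⁻¹ g⁻¹-inverse h⁻¹-inverse →
    ρ∈𝓡𝓛𝓟 g⁻¹ h⁻¹ g⁻¹-inverse h⁻¹-inverse ,
    principalIsotopic g⁻¹ h⁻¹ g⁻¹-inverse h⁻¹-inverse
  where
  open import Data.Product using (_,_)
  open FiniteField F card
  open Reduction f a b f∈𝓛𝓟 f[a,b]≈0
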